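{- Let $G=(V,E)$ be a connected graph, $G'=(V,E')$ any graph on the same node set, and $\mu:E'\to\mathbb{R}^+$ any function. Let $E'':=E\cup E'$ and $G'':=(V,E'')$. Then the function $d^\mu_{E'}:X_{GG''}\times X_{GG''}\to\mathbb{R}_0^+$ defined by $$d^\mu_{E'}(x,x'):=\sum_{e\in E'}\mu_e\,d^1_e(x,x')$$ is a pseudo-metric on $X_{GG''}$. Moreover, $d^\mu_{E'}$ is a metric on $X_{GG''}$ if and only if $E\subseteq E'$.
   Context: All graphs are finite, simple and undirected; an edge $\{v,w\}$ is also written $vw$. Paths and cycles have no repeated nodes and are identified with their edge sets. For distinct $v,w\in V$, $vw\text{ -paths}(G)$ is the set of all paths in $G$ from $v$ to $w$; a $vw$-cut of $G$ is an inclusion-minimal set $C\subseteq E$ such that $v$ and $w$ are not connected in $(V,E\setminus C)$, and $vw\text{ -cuts}(G)$ is the set of all of these. For a connected graph $G=(V,E)$ and a graph $G''=(V,E'')$ with $E\subseteq E''$, let $F_{GG''}:=E''\setminus E$ and let $X_{GG''}$ be the set of all $x\in\{0,1\}^{E''}$ such that (i) $x_e\le\sum_{e'\in C\setminus\{e\}}x_{e'}$ for every cycle $C$ of $G$ and every $e\in C$; (ii) $x_{vw}\le\sum_{e\in P}x_e$ for every $vw\in F_{GG''}$ and every $P\in vw\text{ -paths}(G)$; (iii) $1-x_{vw}\le\sum_{e\in C}(1-x_e)$ for every $vw\in F_{GG''}$ and every $C\in vw\text{ -cuts}(G)$. $\mathbb{R}^+$ denotes the positive reals and $\mathbb{R}^+_0$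 the non-negative reals. $d^1_e(x,x'):=0$ if $x_e=x'_e$ and $d^1_e(x,x'):=1$ otherwise. A pseudo-metric satisfies all axioms of a metric except that distinct points may have distance $0$. -}

module Defs where

open import Data.Bool.Base using (Bool; T; _∧_; _∨_; not; if_then_else_)
open import Data.Bool.Properties using (T?; T-∨; T-∧)
open import Data.Fin.Base as Fin using (Fin; toℕ)
import Data.Fin.Properties as Fin
open import Data.List.Base
  using (List; []; _∷_; map; foldr; filter; length; mapMaybe; allFin; cartesianProduct)
open import Data.List.Membership.Propositional using (_∈_)
open import Data.List.Relation.Unary.Unique.Propositional using (Unique)
open import Data.Maybe.Base using (Maybe; just; nothing)
open import Data.Nat.Base as ℕ using (ℕ)
open import Data.Nat.ListAction using (sum)
import Data.Nat.Properties as ℕ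
open import Data.Product.Base using (Σ-syntax; ∃-syntax; _×_; _,_; proj₁; proj₂)
open import Data.Product.Properties using (≡-dec)
open import Data.Rational.Base as ℚ using (ℚ; 0ℚ; 1ℚ; ½)
import Data.Rational.Properties as ℚ
open import Data.Rational.Solver using (module +-*-Solver)
open import Data.Refinement using (Refinement; Refinement-syntax; value; refine; _,_)
import Data.Refinement as Refinement
open import Data.Irrelevant using ([_])
open import Data.Sum.Base using (_⊎_; inj₁; inj₂)
import Function.Metric.Structures as Metric
open import Function.Base using (_∘_)
open import Function.Bundles using (Equivalence)
open import Function.Metric.Definitions using (Symmetric; TriangleInequality)
open import Level using (_⊔_; 0ℓ)
open import Relation.Binary.Core using (Rel)
open import Relation.Binary.Definitions using (DecidableEquality)
open import Relation.Binary.PropositionalEquality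
  using (_≡_; refl; sym; trans; cong; cong₂; subst)
open import Relation.Nullary.Decidable using (yes; no; does; ¬?)
open import Relation.Nullary.Negation using (¬_)
open import Relation.Unary using (Pred; Decidable)

private
  variable
    n : ℕ

-- Real numbers are Cauchy sequences of rationals; _≃_ is their equality.

IsCauchy : (ℕ → ℚ) → Set
IsCauchy a = ∀ ε → 0ℚ ℚ.< ε →
  ∃[ N ] (∀ i j → N ℕ.≤ i → N ℕ.≤ j → ℚ.∣ a i ℚ.- a j ∣ ℚ.< ε)

record ℝ : Set where
  constructor mkℝ
  field
    seq    : ℕ → ℚ
    cauchy : IsCauchy seq

open ℝ public

infix 4 _≃_ _≤ℝ_ _<ℝ_

_≃_ : Rel ℝ 0ℓ
a ≃ b = ∀ ε → 0ℚ ℚ.< ε →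
  ∃[ N ] (∀ i → N ℕ.≤ i → ℚ.∣ seq a i ℚ.- seq b i ∣ ℚ.< ε)

_≤ℝ_ : Rel ℝ 0ℓ
a ≤ℝ b = ∀ ε → 0ℚ ℚ.< ε →
  ∃[ N ] (∀ i → N ℕ.≤ i → seq a i ℚ.< seq b i ℚ.+ ε)

_<ℝ_ : Rel ℝ 0ℓ
a <ℝ b = ∃[ ε ] 0ℚ ℚ.< ε ×
  ∃[ N ] (∀ i → N ℕ.≤ i → seq a i ℚ.+ ε ℚ.< seq b i)

fromℚ : ℚ → ℝ
fromℚ q = mkℝ (λ _ → q) λ ε 0<ε →
  0 , λ _ _ _ _ → subst (λ r → ℚ.∣ r ∣ ℚ.< ε) (sym (ℚ.+-inverseʳ q)) 0<ε

0ℝ 1ℝ : ℝ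
0ℝ = fromℚ 0ℚ
1ℝ = fromℚ 1ℚ

0<½* : ∀ {ε} → 0ℚ ℚ.< ε → 0ℚ ℚ.< ½ ℚ.* ε
0<½* {ε} 0<ε = subst (ℚ._< ½ ℚ.* ε) (ℚ.*-zeroʳ ½) (ℚ.*-monoʳ-<-pos ½ 0<ε)

½*+½* : ∀ ε → ½ ℚ.* ε ℚ.+ ½ ℚ.* ε ≡ ε
½*+½* ε = trans (sym (ℚ.*-distribʳ-+ ε ½ ½)) (ℚ.*-identityˡ ε)

private
  open +-*-Solver

  +-cauchy : ∀ a b → IsCauchy a → IsCauchy b → IsCauchy (λ i → a i ℚ.+ b i)
  +-cauchy a b ca cb ε 0<ε
    with M , pa ← ca (½ ℚ.* ε) (0<½* 0<ε)
       | N , pb ← cb (½ ℚ.* ε) (0<½* 0<ε)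
    = M ℕ.⊔ N , λ i j ≤i ≤j → begin-strict
      ℚ.∣ (a i ℚ.+ b i) ℚ.- (a j ℚ.+ b j) ∣
        ≡⟨ cong ℚ.∣_∣ (rearrange (a i) (b i) (a j) (b j)) ⟩
      ℚ.∣ (a i ℚ.- a j) ℚ.+ (b i ℚ.- b j) ∣
        ≤⟨ ℚ.∣p+q∣≤∣p∣+∣q∣ (a i ℚ.- a j) (b i ℚ.- b j) ⟩
      ℚ.∣ a i ℚ.- a j ∣ ℚ.+ ℚ.∣ b i ℚ.- b j ∣
        <⟨ ℚ.+-mono-< (pa i j (ℕ.m⊔n≤o⇒m≤o M N ≤i) (ℕ.m⊔n≤o⇒m≤o M N ≤j))
                      (pb i j (ℕ.m⊔n≤o⇒n≤o M N ≤i) (ℕ.m⊔n≤o⇒n≤o M N ≤j)) ⟩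
      ½ ℚ.* ε ℚ.+ ½ ℚ.* ε
        ≡⟨ ½*+½* ε ⟩
      ε ∎
    where
    open ℚ.≤-Reasoning
    rearrange : ∀ p q r s → (p ℚ.+ q) ℚ.- (r ℚ.+ s) ≡ (p ℚ.- r) ℚ.+ (q ℚ.- s)
    rearrange = solve 4 (λ p q r s →
      (p :+ q) :- (r :+ s) := (p :- r) :+ (q :- s)) refl

  bounded : ∀ a → IsCauchy a →
            Σ[ B ∈ ℚ ] ℚ.Positive B × (∃[ N ] (∀ i → N ℕ.≤ i → ℚ.∣ a i ∣ ℚ.≤ B))
  bounded a ca with N , p ← ca 1ℚ (ℚ.positive⁻¹ 1ℚ)
    = B , ℚ.positive 0<B , N , λ i N≤i → begin
      ℚ.∣ a i ∣                               ≡⟨ cong ℚ.∣_∣ (split (a i) (a N)) ⟩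
      ℚ.∣ a N ℚ.+ (a i ℚ.- a N) ∣             ≤⟨ ℚ.∣p+q∣≤∣p∣+∣q∣ (a N) (a i ℚ.- a N) ⟩
      ℚ.∣ a N ∣ ℚ.+ ℚ.∣ a i ℚ.- a N ∣         ≤⟨ ℚ.+-monoʳ-≤ ℚ.∣ a N ∣
                                                   (ℚ.<⇒≤ (p i N N≤i ℕ.≤-refl)) ⟩
      B                                       ∎
    where
    open ℚ.≤-Reasoning
    B = ℚ.∣ a N ∣ ℚ.+ 1ℚ
    0<B : 0ℚ ℚ.< B
    0<B = ℚ.+-mono-≤-< (ℚ.0≤∣p∣ (a N)) (ℚ.positive⁻¹ 1ℚ)
    split : ∀ p q → p ≡ q ℚ.+ (p ℚ.- q)
    split = solve 2 (λ p q → p := q :+ (p :- q)) refl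

  scaled : ∀ b → IsCauchy b → ∀ B → .{{ℚ.Positive B}} → ∀ ε → 0ℚ ℚ.< ε →
           ∃[ N ] (∀ i j → N ℕ.≤ i → N ℕ.≤ j → B ℚ.* ℚ.∣ b i ℚ.- b j ∣ ℚ.< ε)
  scaled b cb B ε 0<ε =
    proj₁ modulus , λ i j ≤i ≤j →
      subst (B ℚ.* ℚ.∣ b i ℚ.- b j ∣ ℚ.<_) B*δ≡ε
        (ℚ.*-monoʳ-<-pos B (proj₂ modulus i j ≤i ≤j))
    where
    instance _ = ℚ.pos⇒nonZero B
    1/B = ℚ.1/ B
    instance _ = ℚ.1/pos⇒pos B
    0<δ : 0ℚ ℚ.< 1/B ℚ.* ε
    0<δ = subst (ℚ._< 1/B ℚ.* ε) (ℚ.*-zeroʳ 1/B) (ℚ.*-monoʳ-<-pos 1/B 0<ε)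
    B*δ≡ε : B ℚ.* (1/B ℚ.* ε) ≡ ε
    B*δ≡ε = trans (sym (ℚ.*-assoc B 1/B ε))
              (trans (cong (ℚ._* ε) (ℚ.*-inverseʳ B)) (ℚ.*-identityˡ ε))
    modulus = cb (1/B ℚ.* ε) 0<δ

  *-estimate : ∀ p q r s {A B δ₁ δ₂} → ℚ.∣ p ∣ ℚ.≤ A → ℚ.∣ s ∣ ℚ.≤ B →
               A ℚ.* ℚ.∣ q ℚ.- s ∣ ℚ.< δ₁ → B ℚ.* ℚ.∣ p ℚ.- r ∣ ℚ.< δ₂ →
               ℚ.∣ p ℚ.* q ℚ.- r ℚ.* s ∣ ℚ.< δ₁ ℚ.+ δ₂
  *-estimate p q r s {A} {B} {δ₁} {δ₂} p≤A s≤B <δ₁ <δ₂ = begin-strict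
    ℚ.∣ p ℚ.* q ℚ.- r ℚ.* s ∣
      ≡⟨ cong ℚ.∣_∣ (rearrange p q r s) ⟩
    ℚ.∣ p ℚ.* (q ℚ.- s) ℚ.+ s ℚ.* (p ℚ.- r) ∣
      ≤⟨ ℚ.∣p+q∣≤∣p∣+∣q∣ (p ℚ.* (q ℚ.- s)) (s ℚ.* (p ℚ.- r)) ⟩
    ℚ.∣ p ℚ.* (q ℚ.- s) ∣ ℚ.+ ℚ.∣ s ℚ.* (p ℚ.- r) ∣
      ≡⟨ cong₂ ℚ._+_ (ℚ.∣p*q∣≡∣p∣*∣q∣ p (q ℚ.- s)) (ℚ.∣p*q∣≡∣p∣*∣q∣ s (p ℚ.- r)) ⟩
    ℚ.∣ p ∣ ℚ.* ℚ.∣ q ℚ.- s ∣ ℚ.+ ℚ.∣ s ∣ ℚ.* ℚ.∣ p ℚ.- r ∣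
      ≤⟨ ℚ.+-mono-≤
           (ℚ.*-monoʳ-≤-nonNeg ℚ.∣ q ℚ.- s ∣ {{ℚ.∣-∣-nonNeg (q ℚ.- s)}} p≤A)
           (ℚ.*-monoʳ-≤-nonNeg ℚ.∣ p ℚ.- r ∣ {{ℚ.∣-∣-nonNeg (p ℚ.- r)}} s≤B) ⟩
    A ℚ.* ℚ.∣ q ℚ.- s ∣ ℚ.+ B ℚ.* ℚ.∣ p ℚ.- r ∣
      <⟨ ℚ.+-mono-< <δ₁ <δ₂ ⟩
    δ₁ ℚ.+ δ₂ ∎
    where
    open ℚ.≤-Reasoning
    rearrange : ∀ p q r s → p ℚ.* q ℚ.- r ℚ.* s ≡ p ℚ.* (q ℚ.- s) ℚ.+ s ℚ.* (p ℚ.- r)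
    rearrange = solve 4 (λ p q r s →
      p :* q :- r :* s := p :* (q :- s) :+ s :* (p :- r)) refl

  *-cauchy : ∀ a b → IsCauchy a → IsCauchy b → IsCauchy (λ i → a i ℚ.* b i)
  *-cauchy a b ca cb ε 0<ε =
    let A , A⁺ , K , pA = bounded a ca
        B , B⁺ , L , pB = bounded b cb
        M , pb          = scaled b cb A {{A⁺}} (½ ℚ.* ε) (0<½* 0<ε)
        N , pa          = scaled a ca B {{B⁺}} (½ ℚ.* ε) (0<½* 0<ε)
    in conclude A B K L M N pA pB pb pa
    where
    conclude : ∀ A B K L M N →
      (∀ i → K ℕ.≤ i → ℚ.∣ a i ∣ ℚ.≤ A) → (∀ i → L ℕ.≤ i → ℚ.∣ b i ∣ ℚ.≤ B) →
      (∀ i j → M ℕ.≤ i → M ℕ.≤ j → A ℚ.* ℚ.∣ b i ℚ.- b j ∣ ℚ.< ½ ℚ.* ε) →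
      (∀ i j → N ℕ.≤ i → N ℕ.≤ j → B ℚ.* ℚ.∣ a i ℚ.- a j ∣ ℚ.< ½ ℚ.* ε) →
      ∃[ P ] (∀ i j → P ℕ.≤ i → P ℕ.≤ j → ℚ.∣ a i ℚ.* b i ℚ.- a j ℚ.* b j ∣ ℚ.< ε)
    conclude A B K L M N pA pB pb pa = (K ℕ.⊔ L) ℕ.⊔ (M ℕ.⊔ N) , λ i j ≤i ≤j →
      let KL≤i = ℕ.m⊔n≤o⇒m≤o (K ℕ.⊔ L) (M ℕ.⊔ N) ≤i
          KL≤j = ℕ.m⊔n≤o⇒m≤o (K ℕ.⊔ L) (M ℕ.⊔ N) ≤j
          MN≤i = ℕ.m⊔n≤o⇒n≤o (K ℕ.⊔ L) (M ℕ.⊔ N) ≤i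
          MN≤j = ℕ.m⊔n≤o⇒n≤o (K ℕ.⊔ L) (M ℕ.⊔ N) ≤j
      in subst (ℚ.∣ a i ℚ.* b i ℚ.- a j ℚ.* b j ∣ ℚ.<_) (½*+½* ε)
           (*-estimate (a i) (b i) (a j) (b j)
             (pA i (ℕ.m⊔n≤o⇒m≤o K L KL≤i)) (pB j (ℕ.m⊔n≤o⇒n≤o K L KL≤j))
             (pb i j (ℕ.m⊔n≤o⇒m≤o M N MN≤i) (ℕ.m⊔n≤o⇒m≤o M N MN≤j))
             (pa i j (ℕ.m⊔n≤o⇒n≤o M N MN≤i) (ℕ.m⊔n≤o⇒n≤o M N MN≤j)))

infixl 6 _+ℝ_
infixl 7 _*ℝ_

_+ℝ_ : ℝ → ℝ → ℝ
a +ℝ b = mkℝ (λ i → seq a i ℚ.+ seq b i) (+-cauchy (seq a) (seq b) (cauchy a) (cauchy b))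

_*ℝ_ : ℝ → ℝ → ℝ
a *ℝ b = mkℝ (λ i → seq a i ℚ.* seq b i) (*-cauchy (seq a) (seq b) (cauchy a) (cauchy b))

ℝ⁺ : Set
ℝ⁺ = Σ[ r ∈ ℝ ] 0ℝ <ℝ r

IsMetric : ∀ {a ℓ} {A : Set a} → Rel A ℓ → (A → A → ℝ) → Set _
IsMetric _≈_ = Metric.IsGeneralMetric _≈_ _≃_ _≤ℝ_ 0ℝ _+ℝ_

-- IsPreMetric comprises d x y ≥ 0, d x x = 0 and compatibility of d with
-- the equalities; compared with IsMetric only d x y = 0 → x = y is missing.
record IsPseudoMetric {a ℓ} {A : Set a} (_≈_ : Rel A ℓ) (d : A → A → ℝ)
                    : Set (a ⊔ ℓ) where
  field
    isPreMetric : Metric.IsPreMetric _≈_ _≃_ _≤ℝ_ 0ℝ d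
    symmetric   : Symmetric _≃_ d
    triangle    : TriangleInequality _≤ℝ_ _+ℝ_ d

-- A two-element set {v , w} of nodes is stored as its increasing pair, so
-- that a simple undirected graph on Fin n is an arbitrary set of such pairs.
NodePair : ℕ → Set
NodePair n = [ p ∈ Fin n × Fin n ∣ proj₁ p Fin.< proj₂ p ]

EdgeSet : ℕ → Set
EdgeSet n = NodePair n → Bool

Graph : ℕ → Set
Graph = EdgeSet

Edge : EdgeSet n → Set
Edge {n} S = [ e ∈ NodePair n ∣ T (S e) ]

_≟ᴱ_ : {S : EdgeSet n} → DecidableEquality (Edge S)
_≟ᴱ_ = Refinement._≟_ (Refinement._≟_ (≡-dec Fin._≟_ Fin._≟_))

infix 4 _⊆_
infixl 6 _∪_ _∖_

_⊆_ : Rel (EdgeSet n) 0ℓ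
S ⊆ S′ = ∀ e → T (S e) → T (S′ e)

_∪_ _∖_ : EdgeSet n → EdgeSet n → EdgeSet n
(S ∪ S′) e = S e ∨ S′ e
(S ∖ S′) e = S e ∧ not (S′ e)

⊆-∪ˡ : (S S′ : EdgeSet n) → S ⊆ S ∪ S′
⊆-∪ˡ _ _ _ = Equivalence.from T-∨ ∘ inj₁

⊆-∪ʳ : (S S′ : EdgeSet n) → S′ ⊆ S ∪ S′
⊆-∪ʳ _ _ _ = Equivalence.from T-∨ ∘ inj₂

∖-⊆ : (S S′ : EdgeSet n) → S ∖ S′ ⊆ S
∖-⊆ _ _ _ = proj₁ ∘ Equivalence.to T-∧

include : {S S′ : EdgeSet n} → S ⊆ S′ → Edge S → Edge S′
include S⊆S′ = refine (S⊆S′ _)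

refine? : ∀ {a p} {A : Set a} {P : Pred A p} → Decidable P → A → Maybe (Refinement A P)
refine? P? a with P? a
... | yes p = just (a , [ p ])
... | no  _ = nothing

nodePairs : ∀ n → List (NodePair n)
nodePairs n = mapMaybe (refine? (λ p → proj₁ p Fin.<? proj₂ p))
                       (cartesianProduct (allFin n) (allFin n))

edgeList : (S : EdgeSet n) → List (Edge S)
edgeList {n} S = mapMaybe (refine? (T? ∘ S)) (nodePairs n)

Joins : {S : EdgeSet n} → Edge S → Fin n → Fin n → Set
Joins e v w = value (value e) ≡ (v , w) ⊎ value (value e) ≡ (w , v)

data Walk (G : Graph n) : Fin n → Fin n → Set where
  []   : ∀ {v} → Walk G v v
  step : ∀ {u v w} (e : Edge G) → Joins e u v → Walk G v w → Walk G u w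

module _ {G : Graph n} where

  nodes : ∀ {v w} → Walk G v w → List (Fin n)
  nodes {v} []           = v ∷ []
  nodes {v} (step _ _ p) = v ∷ nodes p

  edges : ∀ {v w} → Walk G v w → List (Edge G)
  edges []           = []
  edges (step e _ p) = e ∷ edges p

record Path (G : Graph n) (v w : Fin n) : Set where
  field
    walk   : Walk G v w
    unique : Unique (nodes walk)

-- The edges of a path or cycle are distinct since its nodes are, so sums
-- over these lists are sums over edge sets.
pathEdges : {G : Graph n} {v w : Fin n} → Path G v w → List (Edge G)
pathEdges P = edges (Path.walk P)

-- A path with at least three nodes, closed up by an edge between its ends.
record Cycle (G : Graph n) : Set where
  field
    {start end} : Fin n
    path        : Path G start end
    long        : 2 ℕ.≤ length (pathEdges path)
    closing     : Edge G
    closes      : Joins closing end start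

cycleEdges : {G : Graph n} → Cycle G → List (Edge G)
cycleEdges C = Cycle.closing C ∷ pathEdges (Cycle.path C)

Connected : Graph n → Set
Connected G = ∀ v w → Path G v w

record IsCut (G : Graph n) (v w : Fin n) (C : EdgeSet n) : Set where
  field
    subset    : C ⊆ G
    separates : ¬ Path (G ∖ C) v w
    minimal   : ∀ C′ → C′ ⊆ C → ¬ Path (G ∖ C′) v w → C ⊆ C′

module _ (G G″ : Graph n) (G⊆G″ : G ⊆ G″) where

  F : EdgeSet n
  F = G″ ∖ G

  -- The values 0 and 1 are natural numbers here, so 1 ∸ x is exact.
  record IsLifting (x : Edge G″ → Fin 2) : Set where
    xᴳ : Edge G → ℕ
    xᴳ e = toℕ (x (include G⊆G″ e))

    xᶠ : Edge F → ℕ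
    xᶠ f = toℕ (x (include (∖-⊆ G″ G) f))

    field
      cycles : ∀ (C : Cycle G) e → e ∈ cycleEdges C →
               xᴳ e ℕ.≤ sum (map xᴳ (filter (λ e′ → ¬? (e′ ≟ᴱ e)) (cycleEdges C)))
      paths  : ∀ f {v w} → Joins f v w → (P : Path G v w) →
               xᶠ f ℕ.≤ sum (map xᴳ (pathEdges P))
      cuts   : ∀ f {v w} → Joins f v w → ∀ C → IsCut G v w C →
               1 ℕ.∸ xᶠ f ℕ.≤
                 sum (map (λ e → 1 ℕ.∸ xᴳ e) (filter (λ e → T? (C (value e))) (edgeList G)))

  X : Set
  X = Σ[ x ∈ (Edge G″ → Fin 2) ] IsLifting x

  _≈_ : Rel X 0ℓ
  (x , _) ≈ (x′ , _) = ∀ e → x e ≡ x′ e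

  d¹ : Edge G″ → X → X → ℝ
  d¹ e (x , _) (x′ , _) = if does (x e Fin.≟ x′ e) then 0ℝ else 1ℝ

  module _ (G′ : Graph n) (G′⊆G″ : G′ ⊆ G″) (μ : Edge G′ → ℝ⁺) where

    d : X → X → ℝ
    d x x′ = foldr _+ℝ_ 0ℝ
      (map (λ e → proj₁ (μ e) *ℝ d¹ (include G′⊆G″ e) x x′) (edgeList G′))

{-# OPTIONS --safe #-}

-- Since the weights are positive, distance 0 means agreement on E′.  For
-- e₀ ∈ E ∖ E′ the all-ones vector and its modification by 0 at e₀ (given by the
-- partitions into singletons, and into the ends of e₀ and singletons) agree on
-- E′, and both lie in X: a cycle has three distinct edges, and a path joining
-- the ends of an edge outside E has two, so enough ones remain, while x = 1
-- outside E makes the cut inequalities trivial.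

module Submission where

open import Defs
open import Data.Bool.Base using (T; not; false; if_then_else_)
open import Data.Bool.Properties using (T?; T-∧; T-∨)
open import Data.Fin.Base as Fin using (Fin; zero; suc)
import Data.Fin.Properties as Fin
open import Data.Irrelevant using ([_])
open import Data.List.Base using (List; []; _∷_; foldr; map; mapMaybe)
open import Data.List.Membership.Propositional using (_∈_)
open import Data.List.Membership.Propositional.Properties
  using (∈-allFin; ∈-cartesianProduct⁺; ∈-filter⁺)
open import Data.List.Properties using (map-cong)
open import Data.List.Relation.Unary.All using (_∷_; lookup)
open import Data.List.Relation.Unary.AllPairs using (_∷_)
import Data.List.Relation.Unary.Any as Any
open import Data.List.Relation.Unary.Any using (here; there)
import Data.List.Relation.Unary.Any.Properties as Any
import Data.Maybe.Relation.Unary.Any as Maybe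
open import Data.Nat.Base as ℕ using (ℕ)
open import Data.Nat.ListAction using (sum)
import Data.Nat.Properties as ℕ
open import Data.Product.Base using (∃-syntax; _×_; _,_; proj₁; proj₂)
open import Data.Product.Properties using (≡-dec)
open import Data.Rational.Base as ℚ using (ℚ; 0ℚ; 1ℚ; ½)
import Data.Rational.Properties as ℚ
open import Data.Rational.Solver using (module +-*-Solver)
open import Data.Refinement using (Refinement; value; _,_)
import Data.Refinement.Properties as Refinement
open import Data.Sum.Base using (_⊎_; inj₁; inj₂; [_,_]′; swap)
open import Function.Base using (_∘_)
open import Function.Bundles using (_⇔_; mk⇔; Equivalence)
open import Function.Metric.Structures using (module IsGeneralMetric)
open import Relation.Binary.Definitions using (DecidableEquality)
open import Relation.Binary.Structures using (IsPartialOrder; IsEquivalence)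
open import Relation.Binary.PropositionalEquality
  using (_≡_; _≢_; refl; sym; trans; cong; cong₂; subst; subst₂; ≢-sym)
open import Relation.Nullary.Decidable
  using (yes; no; does; ¬?; dec-true; dec-false; decidable-stable; from-yes; recompute)
open import Relation.Nullary.Negation using (¬_; contradiction; contradiction-irr)
open import Relation.Unary using (Pred; Decidable)

private
  variable
    n : ℕ

-- Order and equality of real numbers

module _ where
  open +-*-Solver

  p-q+q≡p : ∀ p q → p ℚ.- q ℚ.+ q ≡ p
  p-q+q≡p = solve 2 (λ p q → p :- q :+ q := p) refl

  p+q-p≡q : ∀ p q → p ℚ.+ q ℚ.- p ≡ q
  p+q-p≡q = solve 2 (λ p q → p :+ q :- p := q) refl

  -[p-q]≡q-p : ∀ p q → ℚ.- (p ℚ.- q) ≡ q ℚ.- p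
  -[p-q]≡q-p = solve 2 (λ p q → :- (p :- q) := q :- p) refl

  +-interchange : ∀ p q r s → (p ℚ.+ q) ℚ.+ (r ℚ.+ s) ≡ (p ℚ.+ r) ℚ.+ (q ℚ.+ s)
  +-interchange = solve 4 (λ p q r s →
    (p :+ q) :+ (r :+ s) := (p :+ r) :+ (q :+ s)) refl

p≤∣p∣ : ∀ p → p ℚ.≤ ℚ.∣ p ∣
p≤∣p∣ p with ℚ.≤-total 0ℚ p
... | inj₁ 0≤p = ℚ.≤-reflexive (sym (ℚ.0≤p⇒∣p∣≡p 0≤p))
... | inj₂ p≤0 = ℚ.≤-trans p≤0 (ℚ.0≤∣p∣ p)

∣p-q∣≡∣q-p∣ : ∀ p q → ℚ.∣ p ℚ.- q ∣ ≡ ℚ.∣ q ℚ.- p ∣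
∣p-q∣≡∣q-p∣ p q = trans (sym (ℚ.∣-p∣≡∣p∣ (p ℚ.- q))) (cong ℚ.∣_∣ (-[p-q]≡q-p p q))

∣p-q∣<ε⇒p<q+ε : ∀ p q {ε} → ℚ.∣ p ℚ.- q ∣ ℚ.< ε → p ℚ.< q ℚ.+ ε
∣p-q∣<ε⇒p<q+ε p q {ε} <ε =
  subst₂ ℚ._<_ (p-q+q≡p p q) (ℚ.+-comm ε q)
    (ℚ.+-monoˡ-< q (ℚ.≤-<-trans (p≤∣p∣ (p ℚ.- q)) <ε))

p<q+ε⇒p-q<ε : ∀ p q {ε} → p ℚ.< q ℚ.+ ε → p ℚ.- q ℚ.< ε
p<q+ε⇒p-q<ε p q {ε} p<q+ε =
  subst (p ℚ.- q ℚ.<_) (p+q-p≡q q ε) (ℚ.+-monoˡ-< (ℚ.- q) p<q+ε)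

∣p-q∣<ε : ∀ p q {ε} → p ℚ.< q ℚ.+ ε → q ℚ.< p ℚ.+ ε → ℚ.∣ p ℚ.- q ∣ ℚ.< ε
∣p-q∣<ε p q {ε} p<q+ε q<p+ε with ℚ.∣p∣≡p∨∣p∣≡-p (p ℚ.- q)
... | inj₁ eq = subst (ℚ._< ε) (sym eq) (p<q+ε⇒p-q<ε p q p<q+ε)
... | inj₂ eq = subst (ℚ._< ε) (sym (trans eq (-[p-q]≡q-p p q))) (p<q+ε⇒p-q<ε q p q<p+ε)

≃⇒≤ℝ : ∀ {a b} → a ≃ b → a ≤ℝ b
≃⇒≤ℝ {a} {b} a≃b ε 0<ε with N , p ← a≃b ε 0<ε =
  N , λ i N≤i → ∣p-q∣<ε⇒p<q+ε (seq a i) (seq b i) (p i N≤i)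

≤ℝ-antisym : ∀ {a b} → a ≤ℝ b → b ≤ℝ a → a ≃ b
≤ℝ-antisym {a} {b} a≤b b≤a ε 0<ε with M , p ← a≤b ε 0<ε | N , q ← b≤a ε 0<ε =
  M ℕ.⊔ N , λ i ≤i → ∣p-q∣<ε (seq a i) (seq b i)
    (p i (ℕ.m⊔n≤o⇒m≤o M N ≤i)) (q i (ℕ.m⊔n≤o⇒n≤o M N ≤i))

≤ℝ-trans : ∀ {a b c} → a ≤ℝ b → b ≤ℝ c → a ≤ℝ c
≤ℝ-trans {a} {b} {c} a≤b b≤c ε 0<ε
  with M , p ← a≤b (½ ℚ.* ε) (0<½* 0<ε) | N , q ← b≤c (½ ℚ.* ε) (0<½* 0<ε) =
  M ℕ.⊔ N , λ i ≤i → begin-strict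
    seq a i                               <⟨ p i (ℕ.m⊔n≤o⇒m≤o M N ≤i) ⟩
    seq b i ℚ.+ ½ ℚ.* ε                   <⟨ ℚ.+-monoˡ-< (½ ℚ.* ε) (q i (ℕ.m⊔n≤o⇒n≤o M N ≤i)) ⟩
    seq c i ℚ.+ ½ ℚ.* ε ℚ.+ ½ ℚ.* ε       ≡⟨ ℚ.+-assoc (seq c i) _ _ ⟩
    seq c i ℚ.+ (½ ℚ.* ε ℚ.+ ½ ℚ.* ε)     ≡⟨ cong (seq c i ℚ.+_) (½*+½* ε) ⟩
    seq c i ℚ.+ ε                         ∎
  where open ℚ.≤-Reasoning

≃-refl : ∀ {a} → a ≃ a
≃-refl {a} ε 0<ε = 0 , λ i _ → subst (λ p → ℚ.∣ p ∣ ℚ.< ε) (sym (ℚ.+-inverseʳ (seq a i))) 0<ε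

≃-sym : ∀ {a b} → a ≃ b → b ≃ a
≃-sym {a} {b} a≃b ε 0<ε with N , p ← a≃b ε 0<ε =
  N , λ i N≤i → subst (ℚ._< ε) (∣p-q∣≡∣q-p∣ (seq a i) (seq b i)) (p i N≤i)

-- Transitivity is inherited from `_≤ℝ_` by antisymmetry, so the halving of ε is carried out only
-- once, in `≤ℝ-trans`.
≃-trans : ∀ {a b c} → a ≃ b → b ≃ c → a ≃ c
≃-trans {a} {b} {c} a≃b b≃c = ≤ℝ-antisym {a} {c}
  (≤ℝ-trans {a} {b} {c} (≃⇒≤ℝ {a} {b} a≃b) (≃⇒≤ℝ {b} {c} b≃c))
  (≤ℝ-trans {c} {b} {a} (≃⇒≤ℝ {c} {b} (≃-sym {b} {c} b≃c))
                        (≃⇒≤ℝ {b} {a} (≃-sym {a} {b} a≃b)))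

≤ℝ-isPartialOrder : IsPartialOrder _≃_ _≤ℝ_
≤ℝ-isPartialOrder = record
  { isPreorder = record
    { isEquivalence = record
      { refl  = λ {a} → ≃-refl {a}
      ; sym   = λ {a b} → ≃-sym {a} {b}
      ; trans = λ {a b c} → ≃-trans {a} {b} {c}
      }
    ; reflexive     = λ {a b} → ≃⇒≤ℝ {a} {b}
    ; trans         = λ {a b c} → ≤ℝ-trans {a} {b} {c}
    }
  ; antisym    = λ {a b} → ≤ℝ-antisym {a} {b}
  }

infix 4 _≲_

-- The sums and products below are computed termwise, so all inequalities
-- between them hold exactly from some index on.
_≲_ : ℝ → ℝ → Set
a ≲ b = ∃[ N ] (∀ i → N ℕ.≤ i → seq a i ℚ.≤ seq b i)

≲-reflexive : ∀ {a b} → (∀ i → seq a i ≡ seq b i) → a ≲ b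
≲-reflexive eq = 0 , λ i _ → ℚ.≤-reflexive (eq i)

≲-trans : ∀ {a b c} → a ≲ b → b ≲ c → a ≲ c
≲-trans (M , p) (N , q) = M ℕ.⊔ N , λ i ≤i →
  ℚ.≤-trans (p i (ℕ.m⊔n≤o⇒m≤o M N ≤i)) (q i (ℕ.m⊔n≤o⇒n≤o M N ≤i))

+-mono-≲ : ∀ {a b c d} → a ≲ b → c ≲ d → a +ℝ c ≲ b +ℝ d
+-mono-≲ (M , p) (N , q) = M ℕ.⊔ N , λ i ≤i →
  ℚ.+-mono-≤ (p i (ℕ.m⊔n≤o⇒m≤o M N ≤i)) (q i (ℕ.m⊔n≤o⇒n≤o M N ≤i))

≲⇒≤ℝ : ∀ {a b} → a ≲ b → a ≤ℝ b
≲⇒≤ℝ {a} {b} (N , p) ε 0<ε = N , λ i N≤i →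
  subst (ℚ._< seq b i ℚ.+ ε) (ℚ.+-identityʳ (seq a i)) (ℚ.+-mono-≤-< (p i N≤i) 0<ε)

≃-pointwise : ∀ {a b} → (∀ i → seq a i ≡ seq b i) → a ≃ b
≃-pointwise {a} {b} eq = ≤ℝ-antisym {a} {b}
  (≲⇒≤ℝ {a} {b} (≲-reflexive {a} {b} eq)) (≲⇒≤ℝ {b} {a} (≲-reflexive {b} {a} (sym ∘ eq)))

≡⇒≃ : ∀ {a b} → a ≡ b → a ≃ b
≡⇒≃ {a} refl = ≃-refl {a}

<-≤-<-cycle : ∀ {p q r} → p ℚ.< q → q ℚ.≤ r → ¬ r ℚ.< p
<-≤-<-cycle p<q q≤r r<p = ℚ.<-irrefl refl (ℚ.<-trans (ℚ.<-≤-trans p<q q≤r) r<p)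

-- The gap ε below `a` also serves as the tolerance for `b ≃ 0ℝ`: at one late index ε < a ≤ b < ε.
<ℝ∧≲⇒≄ : ∀ {a b} → 0ℝ <ℝ a → a ≲ b → ¬ b ≃ 0ℝ
<ℝ∧≲⇒≄ {a} {b} (ε , 0<ε , M , ε<a) (N , a≤b) b≃0 =
  let L , b<ε = ≃⇒≤ℝ {b} {0ℝ} b≃0 ε 0<ε
      i       = M ℕ.⊔ N ℕ.⊔ L
      MN≤i    = ℕ.m≤m⊔n (M ℕ.⊔ N) L
  in <-≤-<-cycle
       (ε<a i (ℕ.≤-trans (ℕ.m≤m⊔n M N) MN≤i))
       (a≤b i (ℕ.≤-trans (ℕ.m≤n⊔m M N) MN≤i))
       (b<ε i (ℕ.m≤n⊔m (M ℕ.⊔ N) L))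

-- Early entries of a positive real may be negative, so its sign can be used only from the index of
-- its gap on.
<ℝ⇒≲ : ∀ {a} → 0ℝ <ℝ a → 0ℝ ≲ a
<ℝ⇒≲ {a} (ε , 0<ε , N , ε<a) = N , λ i N≤i →
  ℚ.<⇒≤ (ℚ.<-trans 0<ε (subst (ℚ._< seq a i) (ℚ.+-identityˡ ε) (ε<a i N≤i)))

-- Finite sums of real numbers

module _ {a} {A : Set a} where

  ∑ : (A → ℝ) → List A → ℝ
  ∑ f xs = foldr _+ℝ_ 0ℝ (map f xs)

  ∑-cong : ∀ f g → (∀ x → f x ≡ g x) → ∀ xs → ∑ f xs ≡ ∑ g xs
  ∑-cong f g f≡g xs = cong (foldr _+ℝ_ 0ℝ) (map-cong f≡g xs)

  ∑-nonNeg : ∀ f → (∀ x → 0ℝ ≲ f x) → ∀ xs → 0ℝ ≲ ∑ f xs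
  ∑-nonNeg f 0≲f []       = 0 , λ _ _ → ℚ.≤-refl
  ∑-nonNeg f 0≲f (x ∷ xs) = +-mono-≲ {0ℝ} {f x} {0ℝ} {∑ f xs} (0≲f x) (∑-nonNeg f 0≲f xs)

  -- Stated entry by entry, because a product with `0ℝ` carries its own sequence and Cauchy proof
  -- and is not the record `0ℝ` itself.
  ∑-zero : ∀ f → (∀ x i → seq (f x) i ≡ 0ℚ) → ∀ xs i → seq (∑ f xs) i ≡ 0ℚ
  ∑-zero f f≡0 []       i = refl
  ∑-zero f f≡0 (x ∷ xs) i = cong₂ ℚ._+_ (f≡0 x i) (∑-zero f f≡0 xs i)

  ∑-triangle : ∀ f g h → (∀ x → f x ≲ g x +ℝ h x) → ∀ xs → ∑ f xs ≲ ∑ g xs +ℝ ∑ h xs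
  ∑-triangle f g h f≲g+h []       = 0 , λ _ _ → ℚ.≤-refl
  ∑-triangle f g h f≲g+h (x ∷ xs) =
    ≲-trans {∑ f (x ∷ xs)} {(g x +ℝ h x) +ℝ (∑ g xs +ℝ ∑ h xs)}
            {∑ g (x ∷ xs) +ℝ ∑ h (x ∷ xs)}
      (+-mono-≲ {f x} {g x +ℝ h x} {∑ f xs} {∑ g xs +ℝ ∑ h xs}
        (f≲g+h x) (∑-triangle f g h f≲g+h xs))
      (≲-reflexive {(g x +ℝ h x) +ℝ (∑ g xs +ℝ ∑ h xs)} {∑ g (x ∷ xs) +ℝ ∑ h (x ∷ xs)}
        λ i → +-interchange (seq (g x) i) (seq (h x) i) (seq (∑ g xs) i) (seq (∑ h xs) i))

  -- All other terms are eventually nonnegative and can be replaced by 0. This lets a single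
  -- positive term keep the whole sum away from 0.
  ∈⇒≲∑ : ∀ f → (∀ x → 0ℝ ≲ f x) → ∀ {x xs} → x ∈ xs → f x ≲ ∑ f xs
  ∈⇒≲∑ f 0≲f {x} {_ ∷ xs} (here refl) =
    ≲-trans {f x} {f x +ℝ 0ℝ} {f x +ℝ ∑ f xs}
      (≲-reflexive {f x} {f x +ℝ 0ℝ} λ i → sym (ℚ.+-identityʳ (seq (f x) i)))
      (+-mono-≲ {f x} {f x} {0ℝ} {∑ f xs}
        (0 , λ _ _ → ℚ.≤-refl) (∑-nonNeg f 0≲f xs))
  ∈⇒≲∑ f 0≲f {x} {y ∷ xs} (there x∈xs) =
    ≲-trans {f x} {0ℝ +ℝ f x} {f y +ℝ ∑ f xs}
      (≲-reflexive {f x} {0ℝ +ℝ f x} λ i → sym (ℚ.+-identityˡ (seq (f x) i)))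
      (+-mono-≲ {0ℝ} {f y} {f x} {∑ f xs} (0≲f y) (∈⇒≲∑ f 0≲f x∈xs))

-- Products with a positive weight

*-nonNeg : ∀ {r t} → 0ℝ <ℝ r → (∀ i → 0ℚ ℚ.≤ seq t i) → 0ℝ ≲ r *ℝ t
*-nonNeg {r} {t} 0<r 0≤t = let N , 0≤r = <ℝ⇒≲ {r} 0<r in N , λ i N≤i →
  subst (ℚ._≤ seq r i ℚ.* seq t i) (ℚ.*-zeroʳ (seq r i))
    (ℚ.*-monoˡ-≤-nonNeg (seq r i) {{ℚ.nonNegative (0≤r i N≤i)}} (0≤t i))

*-triangle : ∀ {r t u v} → 0ℝ <ℝ r → (∀ i → seq t i ℚ.≤ seq u i ℚ.+ seq v i) →
             r *ℝ t ≲ r *ℝ u +ℝ r *ℝ v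
*-triangle {r} {t} {u} {v} 0<r t≤u+v = let N , 0≤r = <ℝ⇒≲ {r} 0<r in N , λ i N≤i →
  subst (seq r i ℚ.* seq t i ℚ.≤_) (ℚ.*-distribˡ-+ (seq r i) (seq u i) (seq v i))
    (ℚ.*-monoˡ-≤-nonNeg (seq r i) {{ℚ.nonNegative (0≤r i N≤i)}} (t≤u+v i))

*-zero : ∀ r {t} → t ≡ 0ℝ → ∀ i → seq (r *ℝ t) i ≡ 0ℚ
*-zero r refl i = ℚ.*-zeroʳ (seq r i)

*-one : ∀ r {t} → t ≡ 1ℝ → r ≲ r *ℝ t
*-one r refl = ≲-reflexive {r} {r *ℝ 1ℝ} λ i → sym (ℚ.*-identityʳ (seq r i))

-- The discrete metric

module _ {k : ℕ} where

  -- This is `d¹` on the two coordinates alone: `d¹ e x y` unfolds to it, so the facts below apply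
  -- to `d¹` without conversion.
  δ : Fin k → Fin k → ℝ
  δ a b = if does (a Fin.≟ b) then 0ℝ else 1ℝ

  δ-refl : ∀ {a b} → a ≡ b → δ a b ≡ 0ℝ
  δ-refl a≡b = cong (if_then 0ℝ else 1ℝ) (dec-true (_ Fin.≟ _) a≡b)

  δ-≢ : ∀ {a b} → a ≢ b → δ a b ≡ 1ℝ
  δ-≢ a≢b = cong (if_then 0ℝ else 1ℝ) (dec-false (_ Fin.≟ _) a≢b)

  δ-sym : ∀ a b → δ a b ≡ δ b a
  δ-sym a b with a Fin.≟ b
  ... | yes a≡b = sym (δ-refl (sym a≡b))
  ... | no a≢b  = sym (δ-≢ (≢-sym a≢b))

  δ-nonNeg : ∀ a b i → 0ℚ ℚ.≤ seq (δ a b) i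
  δ-nonNeg a b i with a Fin.≟ b
  ... | yes _ = ℚ.≤-refl
  ... | no _  = from-yes (0ℚ ℚ.≤? 1ℚ)

  δ-triangle : ∀ a b c i → seq (δ a c) i ℚ.≤ seq (δ a b) i ℚ.+ seq (δ b c) i
  δ-triangle a b c i with a Fin.≟ b | b Fin.≟ c | a Fin.≟ c
  ... | yes refl | yes refl | yes _   = ℚ.≤-refl
  -- The only case that would demand 1 ≤ 0 + 0; transitivity of equality excludes it.
  ... | yes refl | yes refl | no a≢a  = contradiction refl a≢a
  ... | yes _    | no _     | yes _   = from-yes (0ℚ ℚ.≤? 0ℚ ℚ.+ 1ℚ)
  ... | yes _    | no _     | no _    = ℚ.≤-refl
  ... | no _     | yes _    | yes _   = from-yes (0ℚ ℚ.≤? 1ℚ ℚ.+ 0ℚ)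
  ... | no _     | yes _    | no _    = ℚ.≤-refl
  ... | no _     | no _     | yes _   = from-yes (0ℚ ℚ.≤? 1ℚ ℚ.+ 1ℚ)
  ... | no _     | no _     | no _    = from-yes (1ℚ ℚ.≤? 1ℚ ℚ.+ 1ℚ)

-- Edges, paths and cycles

∈-mapMaybe-refine? : ∀ {a p} {A : Set a} {P : Pred A p} (P? : Decidable P) {xs} →
                     (r : Refinement A P) → value r ∈ xs → r ∈ mapMaybe (refine? P?) xs
∈-mapMaybe-refine? {A = A} {P} P? {xs} r r∈xs =
  Any.mapMaybe⁺ (refine? P?) xs (Any.map⁺ (Any.map (λ { refl → found r }) r∈xs))
  where
  found : (r : Refinement A P) → Maybe.Any (r ≡_) (refine? P? (value r))
  found (a , [ p ]) with P? a
  -- The membership proof is irrelevant, so the one found by `P?` gives the same element as the one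
  -- stored in the refinement.
  ... | yes _ = Maybe.just refl
  ... | no ¬p = contradiction-irr p ¬p

-- The list arises by two selections, increasing pairs among all pairs and then members of `S`, and
-- an edge survives both. Hence the sum defining the distance misses no edge of E′.
∈-edgeList : {S : EdgeSet n} (e : Edge S) → e ∈ edgeList S
∈-edgeList {S = S} e = ∈-mapMaybe-refine? (T? ∘ S) e
  (∈-mapMaybe-refine? (λ p → proj₁ p Fin.<? proj₂ p) (value e)
    (∈-cartesianProduct⁺ (∈-allFin _) (∈-allFin _)))

_≟ᴺ_ : DecidableEquality (NodePair n)
_≟ᴺ_ = Refinement._≟_ (≡-dec Fin._≟_ Fin._≟_)

T-not⇒¬T : ∀ {b} → T (not b) → ¬ T b
T-not⇒¬T {false} _ ()

-- An edge stores its membership proof irrelevantly; decidability allows a usable one to be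
-- recomputed.
∈S : {S : EdgeSet n} (e : Edge S) → T (S (value e))
∈S {S = S} (e , [ p ]) = recompute (T? (S e)) p

∉-∖ : (S S′ : EdgeSet n) (e : Edge (S ∖ S′)) → ¬ T (S′ (value e))
∉-∖ S S′ e = T-not⇒¬T (proj₂ (Equivalence.to (T-∧ {S (value e)}) (∈S e)))

ordered : (e : NodePair n) → proj₁ (value e) Fin.< proj₂ (value e)
ordered (e , [ p ]) = recompute (proj₁ e Fin.<? proj₂ e) p

module _ {S S′ : EdgeSet n} (e : Edge S) (f : Edge S′) where

  -- There are no parallel edges: if the two pairs were stored in opposite orders, both v < w and w
  -- < v would hold.
  Joins-common : ∀ {v w} → Joins e v w → Joins f v w → value e ≡ value f
  Joins-common (inj₁ p) (inj₁ q) = Refinement.value-injective (trans p (sym q))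
  Joins-common (inj₂ p) (inj₂ q) = Refinement.value-injective (trans p (sym q))
  Joins-common (inj₁ p) (inj₂ q) = contradiction
    (subst (λ a → proj₁ a Fin.< proj₂ a) q (ordered (value f)))
    (ℕ.<-asym (subst (λ a → proj₁ a Fin.< proj₂ a) p (ordered (value e))))
  Joins-common (inj₂ p) (inj₁ q) = contradiction
    (subst (λ a → proj₁ a Fin.< proj₂ a) q (ordered (value f)))
    (ℕ.<-asym (subst (λ a → proj₁ a Fin.< proj₂ a) p (ordered (value e))))

module _ {S : EdgeSet n} (e : Edge S) where

  Joins-irrefl : ∀ {v} → ¬ Joins e v v
  Joins-irrefl = [ irrefl , irrefl ]′
    where
    irrefl : ∀ {v} → value (value e) ≢ (v , v)
    irrefl eq = ℕ.<-irrefl refl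
      (subst (λ a → proj₁ a Fin.< proj₂ a) eq (ordered (value e)))

  Joins-end : ∀ {u v s t} → Joins e u v → Joins e s t → u ≡ s ⊎ u ≡ t
  Joins-end (inj₁ p) (inj₁ q) = inj₁ (cong proj₁ (trans (sym p) q))
  Joins-end (inj₁ p) (inj₂ q) = inj₂ (cong proj₁ (trans (sym p) q))
  Joins-end (inj₂ p) (inj₁ q) = inj₂ (cong proj₂ (trans (sym p) q))
  Joins-end (inj₂ p) (inj₂ q) = inj₁ (cong proj₂ (trans (sym p) q))

  -- The node u is an end of `e` but not of `f`. This is how distinct nodes of a path yield distinct
  -- edges.
  Joins-≢ : ∀ {u v s t} (f : Edge S) → Joins e u v → Joins f s t → u ≢ s → u ≢ t → e ≢ f
  Joins-≢ f j k u≢s u≢t refl = [ u≢s , u≢t ]′ (Joins-end j k)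

module _ {G : Graph n} where

  start∈nodes : ∀ {v w} (p : Walk G v w) → v ∈ nodes p
  start∈nodes []           = here refl
  start∈nodes (step _ _ _) = here refl

  end∈nodes : ∀ {v w} (p : Walk G v w) → w ∈ nodes p
  end∈nodes []           = here refl
  end∈nodes (step _ _ p) = there (end∈nodes p)

module _ {a} {A : Set a} (_≟_ : DecidableEquality A) where

  avoid₁ : ∀ {x y xs} → x ≢ y → x ∈ xs → y ∈ xs → ∀ a → ∃[ z ] z ∈ xs × z ≢ a
  avoid₁ {x} {y} x≢y x∈ y∈ a with x ≟ a
  ... | no x≢a   = x , x∈ , x≢a
  ... | yes refl = y , y∈ , ≢-sym x≢y

  -- If neither x nor y will do, then, being distinct, they use up both forbidden values, and z is
  -- free.
  avoid₂ : ∀ {x y z xs} → x ≢ y → x ≢ z → y ≢ z → x ∈ xs → y ∈ xs → z ∈ xs →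
           ∀ a b → ∃[ w ] w ∈ xs × w ≢ a × w ≢ b
  avoid₂ {x} {y} {z} x≢y x≢z y≢z x∈ y∈ z∈ a b with x ≟ a | x ≟ b | y ≟ a | y ≟ b
  ... | no x≢a   | no x≢b   | _        | _        = x , x∈ , x≢a , x≢b
  ... | _        | _        | no y≢a   | no y≢b   = y , y∈ , y≢a , y≢b
  ... | yes refl | _        | yes refl | _        = contradiction refl x≢y
  ... | yes refl | _        | no _     | yes refl = z , z∈ , ≢-sym x≢z , ≢-sym y≢z
  ... | no _     | yes refl | yes refl | _        = z , z∈ , ≢-sym y≢z , ≢-sym x≢z
  ... | no _     | yes refl | no _     | yes refl = contradiction refl x≢y

module _ {G : Graph n} where

  -- With no edge the path would make `f` a loop, and with one edge it would put `f` into `G`.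
  -- Otherwise its first two edges differ, since the second misses the start node, and at most one
  -- of them is `e₀`.
  path-avoiding : ∀ {v w} {S : EdgeSet n} (f : Edge S) → Joins f v w →
                  ¬ T (G (value f)) → (P : Path G v w) → ∀ e₀ →
                  ∃[ e ] e ∈ pathEdges P × e ≢ e₀
  path-avoiding f j f∉G record { walk = [] } e₀ = contradiction j (Joins-irrefl f)
  path-avoiding f j f∉G record { walk = step e k [] } e₀ =
    contradiction (subst (T ∘ G) (Joins-common e f k j) (∈S e)) f∉G
  path-avoiding f j f∉G
    record { walk = step e₁ j₁ (step e₂ j₂ p) ; unique = (u≢v ∷ u∉p) ∷ _ } e₀ =
    avoid₁ _≟ᴱ_ (Joins-≢ e₁ e₂ j₁ j₂ u≢v (lookup u∉p (start∈nodes p)))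
      (here refl) (there (here refl)) e₀

  -- Two edges must be avoided: `e` is left out of the sum in the cycle inequality, and `e₀` may
  -- carry the value 0. The first two path edges and the closing edge are three distinct candidates.
  cycle-avoiding : (C : Cycle G) → ∀ e e₀ → ∃[ e′ ] e′ ∈ cycleEdges C × e′ ≢ e × e′ ≢ e₀
  cycle-avoiding record { path = record { walk = [] } ; long = () }
  cycle-avoiding record { path = record { walk = step _ _ [] } ; long = ℕ.s≤s () }
  -- The closing edge misses the second node of the path.
  cycle-avoiding record
    { path    = record { walk = step e₁ j₁ (step e₂ j₂ p)
                       ; unique = (u≢v ∷ u∉p) ∷ v∉p ∷ _ }
    ; closing = c
    ; closes  = k } =
    avoid₂ _≟ᴱ_
      (Joins-≢ e₁ e₂ j₁ j₂ u≢v (lookup u∉p (start∈nodes p)))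
      (Joins-≢ e₁ c (swap j₁) k v≢end (≢-sym u≢v))
      (Joins-≢ e₂ c j₂ k v≢end (≢-sym u≢v))
      (there (here refl)) (there (there (here refl))) (here refl)
    where v≢end = lookup v∉p (end∈nodes p)

∈⇒≤sum : ∀ {a} {A : Set a} (f : A → ℕ) {x xs} → x ∈ xs → f x ℕ.≤ sum (map f xs)
∈⇒≤sum f (here refl)              = ℕ.m≤m+n _ _
∈⇒≤sum f {xs = y ∷ _} (there x∈xs) = ℕ.m≤n⇒m≤o+n (f y) (∈⇒≤sum f x∈xs)

-- Vectors with at most one zero

one : Fin 2
one = suc zero

-- Taking node pairs as arguments makes edges of different graphs on the same nodes comparable.
zeroAt : NodePair n → NodePair n → Fin 2
zeroAt e₀ e = if does (e ≟ᴺ e₀) then zero else one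

zeroAt-≡ : (e₀ : NodePair n) → zeroAt e₀ e₀ ≡ zero
zeroAt-≡ e₀ = cong (if_then zero else one) (dec-true (e₀ ≟ᴺ e₀) refl)

zeroAt-≢ : {e₀ e : NodePair n} → e ≢ e₀ → zeroAt e₀ e ≡ one
zeroAt-≢ e≢e₀ = cong (if_then zero else one) (dec-false (_ ≟ᴺ _) e≢e₀)

module _ (G G″ : Graph n) (G⊆G″ : G ⊆ G″) where

  -- The value at `e₀` is left open, so that the all-ones vector and its modification at `e₀` are
  -- covered together.
  nearly-one⇒IsLifting : (e₀ : Edge G) (x : Edge G″ → Fin 2) →
                         (∀ e → value e ≢ value e₀ → x e ≡ one) → IsLifting G G″ G⊆G″ x
  nearly-one⇒IsLifting e₀ x x≡1 = record
    { cycles = λ C e e∈C →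
        let e′ , e′∈C , e′≢e , e′≢e₀ = cycle-avoiding C e e₀
        in bound _ _ (∈-filter⁺ (λ e″ → ¬? (e″ ≟ᴱ e)) e′∈C e′≢e) e′≢e₀
    ; paths  = λ f j P →
        let e , e∈P , e≢e₀ = path-avoiding f j (∉-∖ G″ G f) P e₀
        in bound _ _ e∈P e≢e₀
    -- Since `f` lies outside `G` and `e₀` inside, the value at `f` is 1 and the left side is 1 ∸ 1
    -- = 0.
    ; cuts   = λ f _ _ _ → ℕ.≤-trans
        (ℕ.≤-reflexive (cong (λ a → 1 ℕ.∸ Fin.toℕ a)
          (x≡1 (include (∖-⊆ G″ G) f)
            λ f≡e₀ → ∉-∖ G″ G f (subst (T ∘ G) (sym f≡e₀) (∈S e₀)))))
        ℕ.z≤n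
    }
    where
    xᴳ : Edge G → ℕ
    xᴳ e = Fin.toℕ (x (include G⊆G″ e))

    -- A coordinate is at most 1, and a single edge other than `e₀` already contributes 1 to the
    -- sum.
    bound : ∀ (a : Fin 2) es {e} → e ∈ es → e ≢ e₀ → Fin.toℕ a ℕ.≤ sum (map xᴳ es)
    bound a es {e} e∈es e≢e₀ = ℕ.≤-trans (Fin.toℕ≤pred[n] a)
      (subst (λ b → Fin.toℕ b ℕ.≤ sum (map xᴳ es))
        (x≡1 (include G⊆G″ e) (e≢e₀ ∘ Refinement.value-injective))
        (∈⇒≤sum xᴳ e∈es))

  -- The distance and its metric axioms

  module _ (G′ : Graph n) (G′⊆G″ : G′ ⊆ G″) (μ : Edge G′ → ℝ⁺) where

    private
      _≈ₓ_ = _≈_ G G″ G⊆G″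
      dμ   = d G G″ G⊆G″ G′ G′⊆G″ μ

      infix 10 _⟨_⟩
      _⟨_⟩ : X G G″ G⊆G″ → Edge G′ → Fin 2
      x ⟨ e ⟩ = proj₁ x (include G′⊆G″ e)

      term : X G G″ G⊆G″ → X G G″ G⊆G″ → Edge G′ → ℝ
      term x y e = proj₁ (μ e) *ℝ d¹ G G″ G⊆G″ (include G′⊆G″ e) x y

    term-nonNeg : ∀ x y e → 0ℝ ≲ term x y e
    term-nonNeg x y e =
      *-nonNeg {proj₁ (μ e)} {d¹ G G″ G⊆G″ (include G′⊆G″ e) x y} (proj₂ (μ e))
        (δ-nonNeg (x ⟨ e ⟩) (y ⟨ e ⟩))

    term-cong : ∀ x y u v e →
                d¹ G G″ G⊆G″ (include G′⊆G″ e) x y ≡ d¹ G G″ G⊆G″ (include G′⊆G″ e) u v →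
                term x y e ≡ term u v e
    term-cong x y u v e = cong (proj₁ (μ e) *ℝ_)

    -- Each term depends on the vectors only through two coordinates, so equal coordinates give
    -- identical reals, Cauchy proofs included, and `≡` holds rather than just `≃`.
    d-cong : ∀ x y u v → x ≈ₓ y → u ≈ₓ v → dμ x u ≡ dμ y v
    d-cong x y u v x≈y u≈v = ∑-cong (term x u) (term y v)
      (λ e → term-cong x u y v e (cong₂ δ (x≈y (include G′⊆G″ e)) (u≈v (include G′⊆G″ e))))
      (edgeList G′)

    d-sym : ∀ x y → dμ x y ≡ dμ y x
    d-sym x y = ∑-cong (term x y) (term y x)
      (λ e → term-cong x y y x e (δ-sym (x ⟨ e ⟩) (y ⟨ e ⟩))) (edgeList G′)

    d-nonNeg : ∀ x y → 0ℝ ≤ℝ dμ x y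
    d-nonNeg x y = ≲⇒≤ℝ {0ℝ} {dμ x y}
      (∑-nonNeg (term x y) (term-nonNeg x y) (edgeList G′))

    d-triangle : ∀ x y z → dμ x z ≤ℝ dμ x y +ℝ dμ y z
    d-triangle x y z = ≲⇒≤ℝ {dμ x z} {dμ x y +ℝ dμ y z}
      (∑-triangle (term x z) (term x y) (term y z)
        (λ e → *-triangle {proj₁ (μ e)}
          {d¹ G G″ G⊆G″ (include G′⊆G″ e) x z}
          {d¹ G G″ G⊆G″ (include G′⊆G″ e) x y}
          {d¹ G G″ G⊆G″ (include G′⊆G″ e) y z}
          (proj₂ (μ e)) (δ-triangle (x ⟨ e ⟩) (y ⟨ e ⟩) (z ⟨ e ⟩)))
        (edgeList G′))

    agree⇒d≃0 : ∀ x y → (∀ e → x ⟨ e ⟩ ≡ y ⟨ e ⟩) → dμ x y ≃ 0ℝ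
    agree⇒d≃0 x y agree = ≃-pointwise {dμ x y} {0ℝ}
      (∑-zero (term x y)
        (λ e → *-zero (proj₁ (μ e)) {d¹ G G″ G⊆G″ (include G′⊆G″ e) x y} (δ-refl (agree e)))
        (edgeList G′))

    -- If the vectors differed at `e`, its term would be at least the positive weight of `e`, and so
    -- would the sum. Equality in `Fin 2` is decidable, so this refutation suffices.
    d≃0⇒agree : ∀ x y → dμ x y ≃ 0ℝ → ∀ e → x ⟨ e ⟩ ≡ y ⟨ e ⟩
    d≃0⇒agree x y d≃0 e = decidable-stable (x ⟨ e ⟩ Fin.≟ y ⟨ e ⟩) λ x≢y →
      <ℝ∧≲⇒≄ {proj₁ (μ e)} {dμ x y} (proj₂ (μ e))
        (≲-trans {proj₁ (μ e)} {term x y e} {dμ x y}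
          (*-one (proj₁ (μ e)) {d¹ G G″ G⊆G″ (include G′⊆G″ e) x y} (δ-≢ x≢y))
          (∈⇒≲∑ (term x y) (term-nonNeg x y) (∈-edgeList e)))
        d≃0

    ≈ₓ-isEquivalence : IsEquivalence _≈ₓ_
    ≈ₓ-isEquivalence = record
      { refl  = λ _ → refl
      ; sym   = λ x≈y e → sym (x≈y e)
      ; trans = λ x≈y y≈z e → trans (x≈y e) (y≈z e)
      }

    d-isPseudoMetric : IsPseudoMetric _≈ₓ_ dμ
    d-isPseudoMetric = record
      { isPreMetric = record
        { isProtoMetric = record
          { isPartialOrder  = ≤ℝ-isPartialOrder
          ; ≈-isEquivalence = ≈ₓ-isEquivalence
          ; cong            = λ {x y u v} x≈y u≈v →
              ≡⇒≃ {dμ x u} {dμ y v} (d-cong x y u v x≈y u≈v)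
          ; nonNegative     = λ {x y} → d-nonNeg x y
          }
        ; ≈⇒0           = λ {x y} x≈y → agree⇒d≃0 x y (x≈y ∘ include G′⊆G″)
        }
      ; symmetric   = λ x y → ≡⇒≃ {dμ x y} {dμ y x} (d-sym x y)
      ; triangle    = d-triangle
      }

    -- When the distance is a metric

    ⊆⇒isMetric : G″ ⊆ G′ → IsMetric _≈ₓ_ dμ
    ⊆⇒isMetric G″⊆G′ = record
      { isSemiMetric = record
        { isQuasiSemiMetric = record
          { isPreMetric = IsPseudoMetric.isPreMetric d-isPseudoMetric
          -- Passing from E″ to E′ and back returns `e` definitionally, because only irrelevant
          -- membership proofs change.
          ; 0⇒≈         = λ {x y} d≃0 e → d≃0⇒agree x y d≃0 (include G″⊆G′ e)
          }
        ; sym               = IsPseudoMetric.symmetric d-isPseudoMetric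
        }
      ; triangle     = d-triangle
      }

    agree⇒≈ : IsMetric _≈ₓ_ dμ → ∀ x y → (∀ e → x ⟨ e ⟩ ≡ y ⟨ e ⟩) → x ≈ₓ y
    agree⇒≈ M x y agree = IsGeneralMetric.0⇒≈ M {x} {y} (agree⇒d≃0 x y agree)

    isMetric⇒⊆ : IsMetric _≈ₓ_ dμ → G ⊆ G′
    isMetric⇒⊆ M e₀ e₀∈G = decidable-stable (T? (G′ e₀)) λ e₀∉G′ →
      -- At `e₀` the two vectors have the values 0 and 1, yet a metric would identify them.
      contradiction (trans (sym (zeroAt-≡ e₀)) (agree⇒≈ M x 𝟏 (agree e₀∉G′) ē₀)) λ ()
      where
      ē₀ : Edge G″
      ē₀ = include G⊆G″ (e₀ , [ e₀∈G ])

      𝟏 x : X G G″ G⊆G″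
      𝟏 = (λ _ → one) , nearly-one⇒IsLifting (e₀ , [ e₀∈G ]) _ (λ _ _ → refl)
      x = zeroAt e₀ ∘ value , nearly-one⇒IsLifting (e₀ , [ e₀∈G ]) _ (λ _ → zeroAt-≢)

      -- The vectors can differ only at `e₀`, which is not among the edges of E′.
      agree : ¬ T (G′ e₀) → ∀ e → x ⟨ e ⟩ ≡ 𝟏 ⟨ e ⟩
      agree e₀∉G′ e = zeroAt-≢ λ e≡e₀ → e₀∉G′ (subst (T ∘ G′) e≡e₀ (∈S e))

theorem5 : ∀ {n : ℕ} (G G′ : Graph n) → Connected G → (μ : Edge G′ → ℝ⁺) →
    let G″     = G ∪ G′
        G⊆G″   = ⊆-∪ˡ G G′
        G′⊆G″  = ⊆-∪ʳ G G′
        _≈ₓ_   = _≈_ G G″ G⊆G″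
        dμ     = d G G″ G⊆G″ G′ G′⊆G″ μ
    in IsPseudoMetric _≈ₓ_ dμ × (IsMetric _≈ₓ_ dμ ⇔ G ⊆ G′)
theorem5 G G′ _ μ =
  d-isPseudoMetric G (G ∪ G′) (⊆-∪ˡ G G′) G′ (⊆-∪ʳ G G′) μ ,
  mk⇔ (isMetric⇒⊆ G (G ∪ G′) (⊆-∪ˡ G G′) G′ (⊆-∪ʳ G G′) μ)
      (λ G⊆G′ → ⊆⇒isMetric G (G ∪ G′) (⊆-∪ˡ G G′) G′ (⊆-∪ʳ G G′) μ
        -- When E lies in E′, the union E″ is contained in E′, so every coordinate is measured.
        λ e → [ G⊆G′ e , (λ e∈G′ → e∈G′) ]′ ∘ Equivalence.to T-∨)
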